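{- Let $b>2$ and $1<n<b$ be integers, and let $p$ be an $(n,b)$-palintiple. Then $p$ is shifted-symmetric if and only if $\gcd(b-n,n^2-1)\ge n+1$.
   Context: Let $b>2$ be an integer base and write $(d_k,d_{k-1},\ldots,d_0)_b=\sum_{j=0}^k d_j b^j$ with $0\le d_j<b$. A natural number $p=(d_k,\ldots,d_0)_b$ with $d_k\neq 0$ and $d_0\neq 0$ that is not a base-$b$ palindrome is an $(n,b)$-palintiple if $(d_k,\ldots,d_0)_b=n\,(d_0,d_1,\ldots,d_k)_b$ for an integer $n$ with $1<n<b$. Its carries $c_0,\ldots,c_{k+1}$ are the carries arising in the base-$b$ multiplication of $(d_0,\ldots,d_k)_b$ by $n$: $c_0=0$ and $n d_{k-j}+c_j=d_j+b\,c_{j+1}$ for $0\le j\le k$ (so $c_{k+1}=0$). The palintiple is shifted-symmetric if $c_j=c_{k-j+1}$ for all $0\le j\le k$. -}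

module Defs where

open import Data.Digit using (Digit)
open import Data.Fin.Base using (Fin; zero; suc; toℕ; fromℕ; inject₁; opposite)
open import Data.Fin.Properties using (toℕ<n)
open import Data.Nat.Base
open import Data.Nat.DivMod
open import Data.Nat.Properties
open import Data.Nat.Tactic.RingSolver using (solve-∀)
open import Data.Product.Base using (_×_; _,_; proj₁; proj₂)
open import Data.Vec.Functional using (Vector; head; tail; reverse)
open import Relation.Binary.PropositionalEquality
open import Relation.Nullary.Negation using (¬_)

open import Algebra.Properties.Monoid.Sum +-0-monoid using (sum-syntax; sum-cong-≗)
open import Algebra.Properties.Semiring.Sum +-*-semiring using (*-distribˡ-sum)

-- Digits are indexed by place value: (d_k , … , d_0)_b is the value of the
-- vector whose j-th entry is d_j.  Hence `reverse d` has j-th entry d_{k-j}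
-- and represents (d_0 , … , d_k)_b.

value : ∀ {b m} → Vector (Digit b) m → ℕ
value {b} {m} d = ∑[ j < m ] (toℕ (d j) * b ^ toℕ j)

-- Carries of the schoolbook multiplication by n in base b, where c is the
-- carry into the units place: the carry out of place j is
-- ⌊ (n e_j + carry into place j) / b ⌋.

mulCarry : ∀ {b m} .{{_ : NonZero b}} → ℕ → ℕ → Vector (Digit b) m → Vector ℕ (suc m)
mulCarry             n c e zero    = c
mulCarry {b} {suc m} n c e (suc j) = mulCarry n ((n * toℕ (head e) + c) / b) (tail e) j

record Palintiple (n b p : ℕ) : Set where
  field
    1<n           : 1 < n
    n<b           : n < b
    k             : ℕ
    digit         : Vector (Digit b) (suc k)
    p≡value       : p ≡ value digit
    leading≢0     : toℕ (digit (fromℕ k)) ≢ 0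
    units≢0       : toℕ (digit zero) ≢ 0
    nonpalindrome : ¬ (digit ≗ reverse digit)
    p≡n*reverse   : p ≡ n * value (reverse digit)

  base-nonZero : NonZero b
  base-nonZero = >-nonZero (≤-<-trans z≤n n<b)

  carry : Vector ℕ (suc (suc k))
  carry = mulCarry {{base-nonZero}} n 0 (reverse digit)

-- For j : Fin (suc k), `suc (opposite j)` is the index k - j + 1.

ShiftedSymmetric : ∀ {n b p} → Palintiple n b p → Set
ShiftedSymmetric P = ∀ (j : Fin (suc k)) → carry (inject₁ j) ≡ carry (suc (opposite j))
  where open Palintiple P

value-∷ : ∀ {b m} (d : Vector (Digit b) (suc m)) →
          value d ≡ toℕ (head d) + b * value (tail d)
value-∷ {b} {m} d = cong₂ _+_ (*-identityʳ _)
  (trans (sum-cong-≗ {m} (λ j → shift (toℕ (d (suc j))) (b ^ toℕ j)))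
         (sym (*-distribˡ-sum {m} b (λ j → toℕ (d (suc j)) * b ^ toℕ j))))
  where
  shift : ∀ x y → x * (b * y) ≡ b * (x * y)
  shift x y = trans (sym (*-assoc x b y)) (trans (cong (_* y) (*-comm x b)) (*-assoc b x y))

mulCarry-spec : ∀ {b m} .{{_ : NonZero b}} n c (e d : Vector (Digit b) m) →
  n * value e + c ≡ value d →
  (∀ j → n * toℕ (e j) + mulCarry n c e (inject₁ j) ≡ toℕ (d j) + b * mulCarry n c e (suc j))
  × mulCarry n c e (fromℕ m) ≡ 0
mulCarry-spec {b} {zero}  n c e d eq = (λ ()) , trans (cong (_+ c) (sym (*-zeroʳ n))) eq
mulCarry-spec {b} {suc m} n c e d eq = rec , proj₂ ih
  where
  t = n * toℕ (head e) + c
  Ve = value (tail e)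
  Vd = value (tail d)

  rearrange : ∀ n x c b v → n * x + c + n * v * b ≡ n * (x + b * v) + c
  rearrange = solve-∀

  total : t + n * Ve * b ≡ toℕ (head d) + Vd * b
  total = begin
    t + n * Ve * b                     ≡⟨ rearrange n (toℕ (head e)) c b Ve ⟩
    n * (toℕ (head e) + b * Ve) + c    ≡⟨ cong (λ v → n * v + c) (sym (value-∷ e)) ⟩
    n * value e + c                    ≡⟨ eq ⟩
    value d                            ≡⟨ value-∷ d ⟩
    toℕ (head d) + b * Vd              ≡⟨ cong (toℕ (head d) +_) (*-comm b Vd) ⟩
    toℕ (head d) + Vd * b              ∎
    where open ≡-Reasoning

  remainder : t % b ≡ toℕ (head d)
  remainder = begin
    t % b                         ≡⟨ sym ([m+kn]%n≡m%n t (n * Ve) b) ⟩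
    (t + n * Ve * b) % b          ≡⟨ cong (_% b) total ⟩
    (toℕ (head d) + Vd * b) % b   ≡⟨ [m+kn]%n≡m%n (toℕ (head d)) Vd b ⟩
    toℕ (head d) % b              ≡⟨ m<n⇒m%n≡m (toℕ<n (head d)) ⟩
    toℕ (head d)                  ∎
    where open ≡-Reasoning

  step : t ≡ toℕ (head d) + b * (t / b)
  step = trans (m≡m%n+[m/n]*n t b) (cong₂ _+_ remainder (*-comm (t / b) b))

  regroup : ∀ x b q w → x + b * q + w * b ≡ x + (w + q) * b
  regroup = solve-∀

  rest : n * Ve + t / b ≡ Vd
  rest = *-cancelʳ-≡ _ _ b (+-cancelˡ-≡ (toℕ (head d)) _ _
    (trans (sym (regroup (toℕ (head d)) b (t / b) (n * Ve)))
           (trans (cong (_+ n * Ve * b) (sym step)) total)))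

  ih = mulCarry-spec n (t / b) (tail e) (tail d) rest

  rec : ∀ j → n * toℕ (e j) + mulCarry n c e (inject₁ j) ≡ toℕ (d j) + b * mulCarry n c e (suc j)
  rec zero    = step
  rec (suc j) = proj₁ ih j

-- n d_{k-j} + c_j = d_j + b c_{j+1} for 0 ≤ j ≤ k, and c_{k+1} = 0.

carry-spec : ∀ {n b p} (P : Palintiple n b p) → let open Palintiple P in
  (∀ j → n * toℕ (reverse digit j) + carry (inject₁ j) ≡ toℕ (digit j) + b * carry (suc j))
  × carry (fromℕ (suc k)) ≡ 0
carry-spec {n} P = mulCarry-spec {{base-nonZero}} n 0 (reverse digit) digit
  (trans (+-identityʳ _) (trans (sym p≡n*reverse) p≡value))
  where open Palintiple P

{-# OPTIONS --safe #-}
-- Write g = gcd (b − n, n² − 1).  Eliminating d_{k-j} from the carry equations at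
-- j and k − j and reducing modulo g, where b ≡ n and n² ≡ 1, gives x_j ≡ n x_{j+1}
-- for x_j = c_j − c_{k-j+1}.  As x_0 = 0, n is a unit modulo g and all carries are
-- below n < g, every x_j vanishes.  Conversely, c_1 = c_k turns the equations at 0
-- and k into (n² − 1) d_0 = (b − n) c_1, so n² − 1 divides g c_1, which is nonzero
-- and at most g (n − 1).
module Submission where

open import Defs
open import Data.Digit using (Digit)
open import Data.Fin.Base using (zero; suc; toℕ; fromℕ; inject₁; opposite)
open import Data.Fin.Induction using (<-weakInduction)
open import Data.Fin.Properties using (toℕ≤pred[n]; opposite-involutive)
open import Data.Nat.Base
  using (ℕ; zero; suc; _<_; _≤_; _≥_; _+_; _*_; _∸_; _^_; _%_; NonZero; >-nonZero; ≢-nonZero; ≢-nonZero⁻¹)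
open import Data.Nat.Divisibility using (_∣_; divides; n∣m*n; m∣m*n; ∣⇒≤)
open import Data.Nat.DivMod using ([m+kn]%n≡m%n; m<n⇒m%n≡m; m<n*o⇒m/o<n)
open import Data.Nat.GCD using (gcd; gcd-greatest; gcd[m,n]∣m; gcd[m,n]∣n; gcd[m,n]≢0; c*gcd[m,n]≡gcd[cm,cn])
open import Data.Nat.Properties
open import Data.Nat.Tactic.RingSolver using (solve-∀)
open import Data.Product.Base using (proj₁; proj₂)
open import Data.Sum.Base using (inj₂)
open import Data.Vec.Functional using (Vector; head; tail; reverse)
open import Function.Bundles using (_⇔_; mk⇔)
open import Relation.Binary.PropositionalEquality

-- A digit is at most one less than the base, so times n and increased by a carry below n it stays
-- below n times the base. Dividing by the base keeps the next carry below n.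
mulCarry<n : ∀ {b m} .{{_ : NonZero b}} n c (e : Vector (Digit b) m) → c < n →
             ∀ j → mulCarry n c e j < n
mulCarry<n                 n c e c<n zero    = c<n
mulCarry<n {suc b} {suc m} n c e c<n (suc j) =
  mulCarry<n n _ (tail e) (m<n*o⇒m/o<n (begin-strict
    n * toℕ (head e) + c  <⟨ +-mono-≤-< (*-monoʳ-≤ n (toℕ≤pred[n] (head e))) c<n ⟩
    n * b + n             ≡⟨ +-comm (n * b) n ⟩
    n + n * b             ≡⟨ sym (*-suc n b) ⟩
    n * suc b             ∎)) j
  where open ≤-Reasoning

opposite-inject₁ : ∀ {k} i → opposite (inject₁ {k} i) ≡ suc (opposite i)
opposite-inject₁ zero    = refl
opposite-inject₁ (suc i) = cong inject₁ (opposite-inject₁ i)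

-- Congruence modulo `g` is expressed by adding explicit multiples to both sides, which avoids
-- subtraction in ℕ.
residue-unique : ∀ {g u v} q q′ → u < g → v < g → u + q * g ≡ v + q′ * g → u ≡ v
residue-unique {suc g} {u} {v} q q′ u<g v<g eq = begin
  u                        ≡⟨ sym (m<n⇒m%n≡m u<g) ⟩
  u % suc g                ≡⟨ sym ([m+kn]%n≡m%n u q (suc g)) ⟩
  (u + q * suc g) % suc g  ≡⟨ cong (_% suc g) eq ⟩
  (v + q′ * suc g) % suc g ≡⟨ [m+kn]%n≡m%n v q′ (suc g) ⟩
  v % suc g                ≡⟨ m<n⇒m%n≡m v<g ⟩
  v                        ∎
  where open ≡-Reasoning

-- Here n + r is the base and s = n² − 1.
carries-congruent : ∀ n r {s} a d e u v → n * n ≡ 1 + s →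
  n * e + a ≡ d + (n + r) * u → n * d + v ≡ e + (n + r) * a →
  v + s * (n * d + v) ≡ u + (s * (n * a + u) + r * (n * (n * a + u)))
-- The padding `n * (d + a)` completes `v` to `n * d + v` and `u` to `n * a + u`, so that `1 + s`,
-- which is n², factors out on each side.
carries-congruent n r {s} a d e u v n²≡1+s eq₁ eq₂ = +-cancelʳ-≡ (n * (d + a)) _ _ (begin
  v + s * (n * d + v) + n * (d + a)
    ≡⟨ lhs n s a d v ⟩
  (1 + s) * (n * d + v) + n * a
    ≡⟨ cong₂ (λ x y → x * y + n * a) (sym n²≡1+s) eq₂ ⟩
  n * n * (e + (n + r) * a) + n * a
    ≡⟨ regroup₁ n r a e ⟩
  n * (n * e + a) + n * n * ((n + r) * a)
    ≡⟨ cong (λ x → n * x + n * n * ((n + r) * a)) eq₁ ⟩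
  n * (d + (n + r) * u) + n * n * ((n + r) * a)
    ≡⟨ regroup₂ n r a d u ⟩
  n * n * (n * a + u) + (n * r * (n * a + u) + n * d)
    ≡⟨ cong (λ x → x * (n * a + u) + (n * r * (n * a + u) + n * d)) n²≡1+s ⟩
  (1 + s) * (n * a + u) + (n * r * (n * a + u) + n * d)
    ≡⟨ rhs n r s a d u ⟩
  u + (s * (n * a + u) + r * (n * (n * a + u))) + n * (d + a) ∎)
  where
  open ≡-Reasoning
  lhs : ∀ n s a d v → v + s * (n * d + v) + n * (d + a) ≡ (1 + s) * (n * d + v) + n * a
  lhs = solve-∀
  regroup₁ : ∀ n r a e → n * n * (e + (n + r) * a) + n * a ≡ n * (n * e + a) + n * n * ((n + r) * a)
  regroup₁ = solve-∀
  regroup₂ : ∀ n r a d u → n * (d + (n + r) * u) + n * n * ((n + r) * a)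
                         ≡ n * n * (n * a + u) + (n * r * (n * a + u) + n * d)
  regroup₂ = solve-∀
  rhs : ∀ n r s a d u → (1 + s) * (n * a + u) + (n * r * (n * a + u) + n * d)
                      ≡ u + (s * (n * a + u) + r * (n * (n * a + u))) + n * (d + a)
  rhs = solve-∀

-- The premises are the carry equations at places 0 and k when c_0 = c_{k+1} = 0 and c_1 = c_k =
-- `c`. Substituting the second into the first eliminates `e`, and `d + n * c` cancels.
outer-digit : ∀ n r {s} d e c → n * n ≡ 1 + s →
  n * e ≡ d + (n + r) * c → n * d + c ≡ e → s * d ≡ c * r
outer-digit n r {s} d _ c n²≡1+s eq refl = +-cancelʳ-≡ (d + n * c) _ _ (begin
  s * d + (d + n * c)   ≡⟨ lhs n s c d ⟩
  (1 + s) * d + n * c   ≡⟨ cong (λ x → x * d + n * c) (sym n²≡1+s) ⟩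
  n * n * d + n * c     ≡⟨ regroup n c d ⟩
  n * (n * d + c)       ≡⟨ eq ⟩
  d + (n + r) * c       ≡⟨ rhs n r c d ⟩
  c * r + (d + n * c)   ∎)
  where
  open ≡-Reasoning
  lhs : ∀ n s c d → s * d + (d + n * c) ≡ (1 + s) * d + n * c
  lhs = solve-∀
  regroup : ∀ n c d → n * n * d + n * c ≡ n * (n * d + c)
  regroup = solve-∀
  rhs : ∀ n r c d → d + (n + r) * c ≡ c * r + (d + n * c)
  rhs = solve-∀

n²≡1+[n²∸1] : ∀ {n} → 0 < n → n * n ≡ 1 + (n ^ 2 ∸ 1)
n²≡1+[n²∸1] {suc n} _ = cong (suc n *_) (sym (*-identityʳ (suc n)))

n²∸1≡[n+1]*[n∸1] : ∀ n → n ^ 2 ∸ 1 ≡ (n + 1) * (n ∸ 1)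
n²∸1≡[n+1]*[n∸1] zero    = refl
n²∸1≡[n+1]*[n∸1] (suc n) = expand n
  where
  expand : ∀ n → n * 1 + n * suc (n * 1) ≡ (suc n + 1) * n
  expand = solve-∀

module _ {n b p} (P : Palintiple n b p) where
  open Palintiple P

  private
    r s g : ℕ
    r = b ∸ n
    s = n ^ 2 ∸ 1
    g = gcd r s

    0<n : 0 < n
    0<n = <⇒≤ 1<n

    n²≡1+s : n * n ≡ 1 + s
    n²≡1+s = n²≡1+[n²∸1] 0<n

    b≡n+r : b ≡ n + r
    b≡n+r = sym (m+[n∸m]≡n (<⇒≤ n<b))

  carry<n : ∀ j → carry j < n
  carry<n = mulCarry<n {{base-nonZero}} n 0 (reverse digit) 0<n

  carry-eq : ∀ j → n * toℕ (digit (opposite j)) + carry (inject₁ j)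
                 ≡ toℕ (digit j) + (n + r) * carry (suc j)
  carry-eq j = trans (proj₁ (carry-spec P) j)
    (cong (λ x → toℕ (digit j) + x * carry (suc j)) b≡n+r)

  carry-eq-opposite : ∀ j → n * toℕ (digit j) + carry (inject₁ (opposite j))
                          ≡ toℕ (digit (opposite j)) + (n + r) * carry (suc (opposite j))
  carry-eq-opposite j = subst
    (λ i → n * toℕ (digit i) + carry (inject₁ (opposite j))
           ≡ toℕ (digit (opposite j)) + (n + r) * carry (suc (opposite j)))
    (opposite-involutive j) (carry-eq (opposite j))

  -- The hypothesis at j makes one value `a` both the carry into place j and the carry out of place
  -- k - j, as `carries-congruent` requires. Carries lie below n, hence below `g`, so congruence
  -- becomes equality.
  symmetry-step : n ≤ g → ∀ j → carry (inject₁ j) ≡ carry (suc (opposite j)) →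
                  carry (suc j) ≡ carry (inject₁ (opposite j))
  symmetry-step n≤g j sym-j with gcd[m,n]∣m r s | gcd[m,n]∣n r s
  ... | divides q r≡q*g | divides t s≡t*g = sym
    -- These are the cofactors left after taking `g` out of `s` and `r` in `carries-congruent`.
    (residue-unique (t * (n * d + v)) (t * (n * a + u) + q * (n * (n * a + u)))
      (below (inject₁ (opposite j))) (below (suc j)) (begin
        v + t * (n * d + v) * g
          ≡⟨ cong (v +_) (trans (swap t _ g) (cong (_* (n * d + v)) (sym s≡t*g))) ⟩
        v + s * (n * d + v)
          ≡⟨ carries-congruent n r a d e u v n²≡1+s (carry-eq j)
               (trans (carry-eq-opposite j) (cong (λ x → e + (n + r) * x) (sym sym-j))) ⟩
        u + (s * w + r * (n * w))
          ≡⟨ cong₂ (λ x y → u + (x * w + y * (n * w))) s≡t*g r≡q*g ⟩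
        u + (t * g * w + q * g * (n * w))
          ≡⟨ cong (u +_) (collect t q w (n * w) g) ⟩
        u + (t * w + q * (n * w)) * g ∎))
    where
    open ≡-Reasoning
    a = carry (inject₁ j)
    d = toℕ (digit j)
    e = toℕ (digit (opposite j))
    u = carry (suc j)
    v = carry (inject₁ (opposite j))
    w = n * a + u
    below : ∀ i → carry i < g
    below i = <-≤-trans (carry<n i) n≤g
    swap : ∀ x y z → x * y * z ≡ x * z * y
    swap = solve-∀
    collect : ∀ t q w w′ g → t * g * w + q * g * w′ ≡ (t * w + q * w′) * g
    collect = solve-∀

  gcd-large⇒shiftedSymmetric : n ≤ g → ShiftedSymmetric P
  -- The base case is c_0 = c_{k+1}: the first is 0 by definition, the second by `carry-spec`.
  gcd-large⇒shiftedSymmetric n≤g = <-weakInduction _ (sym (proj₂ (carry-spec P))) λ i sym-i →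
    trans (symmetry-step n≤g (inject₁ i) sym-i)
          (cong (λ j → carry (inject₁ j)) (opposite-inject₁ i))

  shiftedSymmetric⇒gcd-large : ShiftedSymmetric P → n + 1 ≤ g
  shiftedSymmetric⇒gcd-large sym-P =
    -- The factor n - 1 of n² - 1 cancels against the bound n - 1 on the carry `c`.
    *-cancelʳ-≤ (n + 1) g (n ∸ 1) {{>-nonZero (m<n⇒0<n∸m 1<n)}} (begin
      (n + 1) * (n ∸ 1)  ≡⟨ sym (n²∸1≡[n+1]*[n∸1] n) ⟩
      s                  ≤⟨ ∣⇒≤ {{cg≢0}} s∣c*g ⟩
      c * g              ≡⟨ *-comm c g ⟩
      g * c              ≤⟨ *-monoʳ-≤ g (<⇒≤pred (carry<n (suc zero))) ⟩
      g * (n ∸ 1)        ∎)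
    where
    open ≤-Reasoning
    c = carry (suc zero)
    d = toℕ (digit zero)
    e = toℕ (digit (fromℕ k))

    sym-c : carry (inject₁ (fromℕ k)) ≡ c
    sym-c = trans (sym-P (fromℕ k)) (cong (λ j → carry (suc j)) (opposite-involutive zero))

    instance
      s-nonZero : NonZero s
      s-nonZero = subst NonZero (sym (n²∸1≡[n+1]*[n∸1] n))
        (m*n≢0 (n + 1) (n ∸ 1)
          {{>-nonZero (m≤n⇒m≤n+o 1 0<n)}} {{>-nonZero (m<n⇒0<n∸m 1<n)}})

      d-nonZero : NonZero d
      d-nonZero = ≢-nonZero units≢0

    s*d≡c*r : s * d ≡ c * r
    s*d≡c*r = outer-digit n r d e c n²≡1+s
      (trans (sym (+-identityʳ (n * e))) (carry-eq zero))
      (begin-equality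
        n * d + c
          ≡⟨ cong (n * d +_) (sym sym-c) ⟩
        n * d + carry (inject₁ (fromℕ k))
          ≡⟨ carry-eq-opposite zero ⟩
        e + (n + r) * carry (suc (fromℕ k))
          ≡⟨ cong (λ x → e + (n + r) * x) (proj₂ (carry-spec P)) ⟩
        e + (n + r) * 0
          ≡⟨ cong (e +_) (*-zeroʳ (n + r)) ⟩
        e + 0
          ≡⟨ +-identityʳ e ⟩
        e ∎)

    -- `c * g` is the gcd of `c * r`, which equals `s * d`, and `c * s`; `s` divides both.
    s∣c*g : s ∣ c * g
    s∣c*g = subst (s ∣_) (sym (c*gcd[m,n]≡gcd[cm,cn] c r s))
      (gcd-greatest (subst (s ∣_) s*d≡c*r (m∣m*n d)) (n∣m*n c))

    cg≢0 : NonZero (c * g)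
    cg≢0 = m*n≢0 c g
      -- If `c` were 0, then `s * d` would be 0, although neither `s` nor the units digit `d`
      -- vanishes.
      {{≢-nonZero λ c≡0 → ≢-nonZero⁻¹ (s * d) {{m*n≢0 s d}} (trans s*d≡c*r (cong (_* r) c≡0))}}
      {{≢-nonZero (gcd[m,n]≢0 r s (inj₂ (≢-nonZero⁻¹ s)))}}

theorem1 : ∀ (b n p : ℕ) → 2 < b → 1 < n → n < b → (P : Palintiple n b p) →
    ShiftedSymmetric P ⇔ gcd (b ∸ n) (n ^ 2 ∸ 1) ≥ n + 1
theorem1 b n p _ _ _ P = mk⇔ (shiftedSymmetric⇒gcd-large P)
  (λ n+1≤g → gcd-large⇒shiftedSymmetric P (≤-trans (m≤m+n n 1) n+1≤g))
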